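{- The limit $\displaystyle\lim_{n\to\infty} \frac{E(n,n)}{n^2}$ exists.
   Context: For $m,n\in\mathbb{N}$, $G(m,n)$ is the grid graph on $[m]\times[n]$ with edges between vertices at Euclidean distance 1. In 2-neighbour bootstrap percolation, a vertex becomes infected once at least 2 of its neighbours are infected, infected vertices stay infected; an initial set $A$ percolates if eventually all vertices are infected. A minimal percolating set is a percolating set none of whose proper subsets percolates. $E(m,n)$ is the maximum size of a minimal percolating set of $G(m,n)$. -}

module Defs where

open import Data.Bool using (Bool; true; false; _∧_; _∨_; if_then_else_)
open import Data.Nat using (ℕ; zero; suc; _+_; _*_; _≤_; _≡ᵇ_; _≤ᵇ_)
open import Data.Fin using (Fin; toℕ)
open import Data.List using (List; allFin; map; concatMap)
open import Data.Nat.ListAction using (sum)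
open import Data.Product using (_×_; _,_; ∃; Σ)
open import Data.Integer using (+_)
open import Data.Rational using (ℚ; _/_)
open import Function using (_∘_)
open import Relation.Binary.PropositionalEquality using (_≡_)
open import Relation.Nullary using (¬_)

Vertex : ℕ → ℕ → Set
Vertex m n = Fin m × Fin n

VSet : ℕ → ℕ → Set
VSet m n = Vertex m n → Bool

allVertices : (m n : ℕ) → List (Vertex m n)
allVertices m n = concatMap (λ i → map (λ j → (i , j)) (allFin n)) (allFin m)

dist1 : ℕ → ℕ → Bool
dist1 a b = (suc a ≡ᵇ b) ∨ (suc b ≡ᵇ a)

adj : {m n : ℕ} → Vertex m n → Vertex m n → Bool
adj (i , j) (i' , j') =
  ((toℕ i ≡ᵇ toℕ i') ∧ dist1 (toℕ j) (toℕ j')) ∨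
  ((toℕ j ≡ᵇ toℕ j') ∧ dist1 (toℕ i) (toℕ i'))

boolToℕ : Bool → ℕ
boolToℕ true = 1
boolToℕ false = 0

card : {m n : ℕ} → VSet m n → ℕ
card {m} {n} A = sum (map (boolToℕ ∘ A) (allVertices m n))

infectedNbrs : {m n : ℕ} → VSet m n → Vertex m n → ℕ
infectedNbrs {m} {n} A v = sum (map (λ w → boolToℕ (adj v w ∧ A w)) (allVertices m n))

step : {m n : ℕ} → VSet m n → VSet m n
step A v = A v ∨ (2 ≤ᵇ infectedNbrs A v)

iter : {m n : ℕ} → ℕ → VSet m n → VSet m n
iter zero A = A
iter (suc t) A = step (iter t A)

Percolates : {m n : ℕ} → VSet m n → Set
Percolates A = ∃ λ t → ∀ v → iter t A v ≡ true

_⊆_ : {m n : ℕ} → VSet m n → VSet m n → Set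
B ⊆ A = ∀ v → B v ≡ true → A v ≡ true

_⊂_ : {m n : ℕ} → VSet m n → VSet m n → Set
B ⊂ A = B ⊆ A × ∃ λ v → (A v ≡ true × B v ≡ false)

MinimalPercolating : {m n : ℕ} → VSet m n → Set
MinimalPercolating A = Percolates A × (∀ B → B ⊂ A → ¬ Percolates B)

IsE : ℕ → ℕ → ℕ → Set
IsE m n k =
  (Σ (VSet m n) λ A → MinimalPercolating A × card A ≡ k) ×
  (∀ (A : VSet m n) → MinimalPercolating A → card A ≤ k)

-- Given e with e k = E(k+1,k+1), the value E(n,n)/n² at n = k+1.
ratio : (ℕ → ℕ) → ℕ → ℚ
ratio e k = (+ e k) / (suc k * suc k)

{-# OPTIONS --safe #-}
module Submission where

-- E is superadditive up to constant margins: E(N,N) ≥ t² E(k,k) whenever N ≥ t (k + 28). Since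
-- 0 ≤ E(n,n) ≤ n², a ratio E(k,k) / k² close to the upper limit is then inherited by all large N.
--
-- For the superadditivity it suffices to build a percolating set many of whose cells are
-- essential, since every minimal percolating subset contains them. Let A percolate in a box and
-- let D be the closure of A without an essential cell, so D is not the whole box. Adding a cell
-- at distance two from the near end of a side extends D along the initial run of that side; a
-- second cell at the far end is reached only if the side is full. Testing two adjacent sides
-- this way, the second test depending on the first, gives a larger box whose outer columns on
-- one side stay empty, except for one cell, unless the original box fills up: two adjacent full
-- sides force all of it. Two boxes guarded in this way are placed with the guarded sides facing
-- each other; they merge if both fill up, and an unfilled one is not helped by the other.
-- Merging costs only a constant number of rows and columns, and since it is done alternately in
-- the two directions along a binary recursion, the total cost stays bounded per tile.

open import Defs
open import Data.Bool using (Bool; true; false; _∧_; _∨_)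
open import Data.Bool.Properties using (T-≡; ∨-zeroʳ)
open import Data.Empty using (⊥; ⊥-elim)
open import Data.Fin using (Fin; toℕ; fromℕ<)
open import Data.Fin.Properties using (toℕ<n; toℕ-fromℕ<; fromℕ<-toℕ; toℕ-injective)
open import Data.Integer using (+<+) renaming (+_ to pos; _*_ to _*ᶻ_; _+_ to _+ᶻ_; _<_ to _<ᶻ_)
import Data.Integer.Properties as ℤ
open import Data.List using (List; []; _∷_; _++_; allFin; map; concatMap; cartesianProduct; tabulate)
open import Data.List.Membership.Propositional using (_∈_)
open import Data.List.Membership.Propositional.Properties using (∈-cartesianProduct⁺; ∈-allFin)
open import Data.List.Properties using (map-++; map-tabulate; map-∘; map-cong)
open import Data.List.Relation.Unary.All using (lookup)
open import Data.List.Relation.Unary.AllPairs using (_∷_)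
open import Data.List.Relation.Unary.Any using (here; there)
open import Data.List.Relation.Unary.Unique.Propositional using (Unique)
open import Data.List.Relation.Unary.Unique.Propositional.Properties using (allFin⁺; cartesianProduct⁺)
open import Data.Nat hiding (∣_-_∣)
open import Data.Nat.Binary.Base using (2[1+_]; 1+[2_]) renaming (zero to 0ᵇ; toℕ to fromBinary; fromℕ to toBinary)
open import Data.Nat.Binary.Properties using (toℕ-fromℕ)
open import Data.Nat.DivMod using (m≡m%n+[m/n]*n; m%n<n)
open import Data.Nat.ListAction using (sum)
open import Data.Nat.ListAction.Properties using (sum-++)
open import Data.Nat.Properties
open import Data.Nat.Solver using (module +-*-Solver)
open import Data.Product using (Σ; ∃; ∃₂; _×_; _,_; proj₁; proj₂; swap)
open import Data.Rational using (ℚ; mkℚ; 0ℚ; toℚᵘ; *<*; ∣_∣; -_; _-_) renaming (_+_ to _+ℚ_; _<_ to _<ℚ_; _/_ to _/ℚ_)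
import Data.Rational.Properties as ℚ
import Data.Rational.Unnormalised as ℚᵘ
import Data.Rational.Unnormalised.Properties as ℚᵘ
open import Data.Sum using (_⊎_; inj₁; inj₂)
open import Function using (_∘_; flip; id; case_of_)
open import Function.Bundles using (Equivalence)
open import Relation.Binary.PropositionalEquality
open import Relation.Nullary using (¬_; yes; no)
open import Relation.Nullary.Decidable using (decidable-stable)
open import Algebra.Properties.CommutativeSemigroup +-commutativeSemigroup using (interchange)
open import Algebra.Properties.Group ℚ.+-0-group using (⁻¹-anti-homo-//)
open +-*-Solver using (solve; _:=_; _:+_; _:*_; con)

Column : Set
Column = ℕ → Bool

-- The first index of a plane is the column, the second the row.
Plane : Set
Plane = ℕ → Column

infixr 5 _◂_
infix 4 _⊑_

_◂_ : Column → Plane → Plane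
(x ◂ f) zero    = x
(x ◂ f) (suc j) = f j

∅ : Column
∅ _ = false

single : ℕ → Column
single p i = i ≡ᵇ p

_⊑_ : Plane → Plane → Set
f ⊑ g = ∀ j i → f j i ≡ true → g j i ≡ true

single⇒≡ : ∀ {p} i → single p i ≡ true → i ≡ p
single⇒≡ {p} i e = ≡ᵇ⇒≡ i p (Equivalence.from T-≡ e)

single-self : ∀ p → single p p ≡ true
single-self p = Equivalence.to T-≡ (≡⇒≡ᵇ p p refl)

true≢false : ∀ {b} → b ≡ true → b ≡ false → ⊥
true≢false refl ()

∧-true : ∀ {a b} → a ∧ b ≡ true → a ≡ true × b ≡ true
∧-true {true} {true} _ = refl , refl

-- Closed planes

VClosed : Column → Set
VClosed x = ∀ i → x i ≡ true → x (2 + i) ≡ true → x (1 + i) ≡ true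

HClosed : Column → Column → Column → Set
HClosed x y z = ∀ i → x i ≡ true → z i ≡ true → y i ≡ true

record Compatible (x y : Column) : Set where
  constructor compatible
  field
    diag : ∀ i → x i ≡ true → y (suc i) ≡ true → x (suc i) ≡ true × y i ≡ true
    anti : ∀ i → x (suc i) ≡ true → y i ≡ true → x i ≡ true × y (suc i) ≡ true

record Closed (f : Plane) : Set where
  constructor closed
  field
    vert  : ∀ j → VClosed (f j)
    adjac : ∀ j → Compatible (f j) (f (1 + j))
    horiz : ∀ j → HClosed (f j) (f (1 + j)) (f (2 + j))

open Compatible
open Closed

compatible-sym : ∀ {x y} → Compatible x y → Compatible y x
compatible-sym c = compatible (λ i p q → swap (anti c i q p)) (λ i p q → swap (diag c i q p))

closed-◂ : ∀ {x f} → VClosed x → Compatible x (f 0) → HClosed x (f 0) (f 1) →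
           Closed f → Closed (x ◂ f)
closed-◂ v a h c = closed
  (λ { zero → v ; (suc j) → vert c j })
  (λ { zero → a ; (suc j) → adjac c j })
  (λ { zero → h ; (suc j) → horiz c j })

closed-tail : ∀ {f} → Closed f → Closed (f ∘ suc)
closed-tail c = closed (vert c ∘ suc) (adjac c ∘ suc) (horiz c ∘ suc)

closed-flip : ∀ {f} → Closed f → Closed (flip f)
closed-flip c = closed
  (λ j i → horiz c i j)
  (λ j → compatible (λ i p q → swap (diag (adjac c i) j p q))
                    (λ i p q → anti (adjac c i) j q p))
  (λ j i → vert c i j)

Supp : ℕ → ℕ → Plane → Set
Supp w h f = ∀ j i → f j i ≡ true → j < w × i < h

FullColumn : ℕ → Column → Set
FullColumn h x = ∀ {i} → i < h → x i ≡ true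

Full : ℕ → ℕ → Plane → Set
Full w h f = ∀ {j} → j < w → FullColumn h (f j)

spread : ∀ {h x y p} → Compatible x y → FullColumn h x → p < h → y p ≡ true → FullColumn h y
spread {h} {x} {y} {p} c full p<h yp = up _
  where
  down : ∀ p → p < h → y p ≡ true → y 0 ≡ true
  down zero    _   e = e
  down (suc p) p<h e = down p (<⇒≤ p<h) (proj₂ (diag c p (full (<⇒≤ p<h)) e))
  up : ∀ i → i < h → y i ≡ true
  up zero    _   = down p p<h yp
  up (suc i) i<h = proj₂ (anti c i (full i<h) (up i (<⇒≤ i<h)))

spread-all : ∀ {w h f p} → Closed f → FullColumn h (f 0) → p < h →
             (∀ {j} → j < w → f j p ≡ true) → Full w h f
spread-all c full p<h hit {zero}  j<w i<h = full i<h
spread-all {suc w} c full p<h hit {suc j} (s≤s j<w) =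
  spread-all (closed-tail c) (spread (adjac c 0) full p<h (hit′ j<w)) p<h (hit ∘ s≤s) j<w
  where
  hit′ : j < w → _
  hit′ j<w = hit (s≤s (≤-trans (s≤s z≤n) j<w))

grow₁ : ∀ {w h f p} → Closed f → p < h → f 0 p ≡ true → 0 < w →
        Full w h (f ∘ suc) → Full (1 + w) h f
grow₁ c p<h e 0<w full {zero}  _         = spread (compatible-sym (adjac c 0)) (full 0<w) p<h e
grow₁ c p<h e 0<w full {suc j} (s≤s j<w) = full j<w

grow₂ : ∀ {w h f p} → Closed f → p < h → f 0 p ≡ true → 0 < w →
        Full w h (f ∘ suc ∘ suc) → Full (2 + w) h f
grow₂ c p<h e 0<w full =
  grow₁ c p<h e (s≤s z≤n)
    (grow₁ (closed-tail c) p<h (horiz c 0 _ e (full 0<w p<h)) 0<w full)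

prefix : Column → Column
prefix x zero    = x zero
prefix x (suc i) = prefix x i ∧ x (suc i)

addTop : Column → Column
addTop x zero    = true
addTop x (suc i) = x (suc i)

prefix⇒ : ∀ {x} i → prefix x i ≡ true → x i ≡ true
prefix⇒ zero    e = e
prefix⇒ (suc i) e = proj₂ (∧-true e)

prefix-pred : ∀ {x} i → prefix x (suc i) ≡ true → prefix x i ≡ true
prefix-pred i e = proj₁ (∧-true e)

prefix-suc : ∀ {x} i → prefix x i ≡ true → x (suc i) ≡ true → prefix x (suc i) ≡ true
prefix-suc i p q = cong₂ _∧_ p q

prefix-down : ∀ {x i n} → i ≤ n → prefix x n ≡ true → prefix x i ≡ true
prefix-down {n = zero}  z≤n e = e
prefix-down {n = suc n} i≤n e with m≤n⇒m<n∨m≡n i≤n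
... | inj₁ (s≤s i≤n′) = prefix-down i≤n′ (prefix-pred n e)
... | inj₂ refl       = e

prefix-full : ∀ {x} n → FullColumn (suc n) x → prefix x n ≡ true
prefix-full zero    full = full (s≤s z≤n)
prefix-full (suc n) full = cong₂ _∧_ (prefix-full n (full ∘ m<n⇒m<1+n)) (full ≤-refl)

full-addTop-prefix : ∀ {x n} → prefix x n ≡ true → FullColumn (suc n) (addTop (prefix x))
full-addTop-prefix e {zero}  _         = refl
full-addTop-prefix e {suc i} (s≤s i≤n) = prefix-down i≤n e

-- Adding the cell (0 , 0) at distance two from the first column of a closed plane spreads
-- exactly along the initial run of that column.
extend : Plane → Plane
extend f = addTop (prefix (f 0)) ◂ prefix (f 0) ◂ f

closed-extend : ∀ {f} → Closed f → Closed (extend f)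
closed-extend {f} c =
  closed-◂ (λ i _ → prefix-pred (suc i))
           (compatible (λ i _ e → e , prefix-pred i e)
                       (λ { zero p _ → refl , p ; (suc i) p q → q , p }))
           (λ { zero _ e → e ; (suc i) e _ → e })
  (closed-◂ (λ i _ → prefix-pred (suc i))
            (compatible (λ i p q → prefix-suc i p q , prefix⇒ i p)
                        (λ i p _ → prefix-pred i p , prefix⇒ (suc i) p))
            (λ i p _ → prefix⇒ i p)
   c)

supp-extend : ∀ {w h f} → Supp (suc w) (suc h) f → Supp (3 + w) (suc h) (extend f)
supp-extend s 0 zero    e = s≤s z≤n , s≤s z≤n
supp-extend s 0 (suc i) e = s≤s z≤n , proj₂ (s 0 (suc i) (prefix⇒ (suc i) e))
supp-extend s 1 i       e = s≤s (s≤s z≤n) , proj₂ (s 0 i (prefix⇒ i e))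
supp-extend s (suc (suc j)) i e = s≤s (s≤s (proj₁ (s j i e))) , proj₂ (s j i e)

closed-guard : ∀ {f p} → Closed f → f 0 p ≡ false → Closed (single p ◂ ∅ ◂ f)
closed-guard {f} {p} c e =
  closed-◂ (λ i q r → ⊥-elim (m≢1+n+m i (trans (single⇒≡ i q) (sym (single⇒≡ (2 + i) r)))))
           (compatible (λ _ _ ()) (λ _ _ ()))
           (λ i q r → ⊥-elim (true≢false (subst (λ k → f 0 k ≡ true) (single⇒≡ i q) r) e))
  (closed-◂ (λ _ ()) (compatible (λ _ ()) (λ _ ())) (λ _ ()) c)

supp-guard : ∀ {w h f p} → p < h → Supp w h f → Supp (2 + w) h (single p ◂ ∅ ◂ f)
supp-guard p<h s 0 i e with refl ← single⇒≡ i e = s≤s z≤n , p<h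
supp-guard p<h s (suc (suc j)) i e = s≤s (s≤s (proj₁ (s j i e))) , proj₂ (s j i e)

sumTo : ℕ → (ℕ → ℕ) → ℕ
sumTo zero    a = 0
sumTo (suc n) a = a 0 + sumTo n (a ∘ suc)

count : ℕ → ℕ → Plane → ℕ
count w h f = sumTo w (λ j → sumTo h (boolToℕ ∘ f j))

sumTo-mono : ∀ n {a b : ℕ → ℕ} → (∀ i → a i ≤ b i) → sumTo n a ≤ sumTo n b
sumTo-mono zero    e = z≤n
sumTo-mono (suc n) e = +-mono-≤ (e 0) (sumTo-mono n (e ∘ suc))

sumTo-monoˡ : ∀ {m n} {a : ℕ → ℕ} → m ≤ n → sumTo m a ≤ sumTo n a
sumTo-monoˡ z≤n     = z≤n
sumTo-monoˡ {a = a} (s≤s p) = +-monoʳ-≤ (a 0) (sumTo-monoˡ p)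

sumTo-zero : ∀ n → sumTo n (λ _ → 0) ≡ 0
sumTo-zero zero    = refl
sumTo-zero (suc n) = sumTo-zero n

sumTo-+ : ∀ n (a b : ℕ → ℕ) → sumTo n (λ i → a i + b i) ≡ sumTo n a + sumTo n b
sumTo-+ zero    a b = refl
sumTo-+ (suc n) a b rewrite sumTo-+ n (a ∘ suc) (b ∘ suc) =
  interchange (a 0) (b 0) (sumTo n (a ∘ suc)) (sumTo n (b ∘ suc))

sumTo-swap : ∀ m n (a : ℕ → ℕ → ℕ) →
             sumTo m (λ j → sumTo n (a j)) ≡ sumTo n (λ i → sumTo m (λ j → a j i))
sumTo-swap zero    n a = sym (sumTo-zero n)
sumTo-swap (suc m) n a =
  trans (cong (sumTo n (a 0) +_) (sumTo-swap m n (a ∘ suc)))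
        (sym (sumTo-+ n (a 0) (λ i → sumTo m (λ j → a (suc j) i))))

boolToℕ-mono : ∀ {a b} → (a ≡ true → b ≡ true) → boolToℕ a ≤ boolToℕ b
boolToℕ-mono {false} _ = z≤n
boolToℕ-mono {true}  f rewrite f refl = ≤-refl

count-mono : ∀ w h {f g} → f ⊑ g → count w h f ≤ count w h g
count-mono w h f⊑g = sumTo-mono w (λ j → sumTo-mono h (λ i → boolToℕ-mono (f⊑g j i)))

-- Percolating sets with essential cells

-- S consists of cells of A that cannot be dropped: if B ⊑ A misses one of them, some closed
-- plane above B has the property K. Essentiality is stated contrapositively.
record System (K : Plane → Set) (w h s : ℕ) : Set where
  field
    A S        : Plane
    supported  : Supp w h A
    percolates : ∀ {C} → Closed C → A ⊑ C → Full w h C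
    essential  : ∀ {B} → B ⊑ A →
                 (∀ {C} → Closed C → Supp w h C → B ⊑ C → ¬ K C) → S ⊑ B
    size       : s ≤ count w h S

open System

Hole : ℕ → ℕ → Plane → Set
Hole w h C = ∃₂ λ j i → j < w × i < h × C j i ≡ false

RowHole : ℕ → Plane → Set
RowHole w C = ∃ λ j → j < w × C j 0 ≡ false

ColumnHole : ℕ → Plane → Set
ColumnHole h C = ∃ λ i → i < h × C 0 i ≡ false

CellFree : ℕ → Plane → Set
CellFree p C = C 0 p ≡ false

Guarded : ℕ → Plane → Set
Guarded p C = (∀ i → C 1 i ≡ false) × (∀ i → C 0 i ≡ true → i ≡ p)

transpose : ∀ {K K′ w h s} → (∀ {C} → K C → K′ (flip C)) → System K w h s → System K′ h w s
transpose {w = w} {h} conv X = record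
  { A          = flip (A X)
  ; S          = flip (S X)
  ; supported  = λ j i e → swap (supported X i j e)
  ; percolates = λ c A⊑C p q → percolates X (closed-flip c) (λ j i → A⊑C i j) q p
  ; essential  = λ B⊑A none j i → essential X (λ j i → B⊑A i j)
                   (λ c s B⊑C k → none (closed-flip c) (λ j i e → swap (s i j e)) (λ j i → B⊑C i j) (conv k)) i j
  ; size       = subst (_ ≤_) (sumTo-swap w h (λ j i → boolToℕ (S X j i))) (size X)
  }

shift : ℕ → Plane → Plane
shift zero    f = f
shift (suc p) f = ∅ ◂ shift p f

shift-+ : ∀ p {f} j i → shift p f (p + j) i ≡ f j i
shift-+ zero    j i = refl
shift-+ (suc p) j i = shift-+ p j i

shift-true : ∀ p {f} j i → shift p f j i ≡ true → ∃ λ j′ → j ≡ p + j′ × f j′ i ≡ true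
shift-true zero    j       i e = j , refl , e
shift-true (suc p) (suc j) i e with j′ , refl , e′ ← shift-true p j i e = j′ , refl , e′

count-shift : ∀ p w h f → count (p + w) h (shift p f) ≡ count w h f
count-shift zero    w h f = refl
count-shift (suc p) w h f = cong₂ _+_ (sumTo-zero h) (count-shift p w h f)

prepend : ∀ {K K′ w h s} p g → g < h →
          (∀ {C} → Closed C → C 0 g ≡ true → Full w h (λ j → C (suc p + j)) → Full (suc p + w) h C) →
          (∀ {C} → Closed C → Supp w h C → K C →
             Σ Plane λ D → Closed D × Supp (suc p + w) h D × D 0 g ≡ true ×
                           (∀ j i → C j i ≡ true → D (suc p + j) i ≡ true) × K′ D) →
          System K w h s → System K′ (suc p + w) h s
prepend {w = w} {h} p g g<h grow certify X = record
  { A          = single g ◂ shift p (A X)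
  ; S          = shift (suc p) (S X)
  ; supported  = supported′
  ; percolates = λ {C} c A⊑C → grow c (A⊑C 0 g (single-self g))
                   (percolates X (closed-shift p (closed-tail c))
                     (λ j i e → A⊑C (suc p + j) i (trans (shift-+ p j i) e)))
  ; essential  = essential′
  ; size       = subst (_ ≤_) (sym (count-shift (suc p) w h (S X))) (size X)
  }
  where
  closed-shift : ∀ p {C} → Closed C → Closed (λ j → C (p + j))
  closed-shift zero    c = c
  closed-shift (suc p) c = closed-shift p (closed-tail c)

  supported′ : Supp (suc p + w) h (single g ◂ shift p (A X))
  supported′ zero    i e with refl ← single⇒≡ i e = s≤s z≤n , g<h
  supported′ (suc j) i e with j′ , refl , e′ ← shift-true p j i e =
    s≤s (+-monoʳ-< p (proj₁ (supported X j′ i e′))) , proj₂ (supported X j′ i e′)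

  essential′ : ∀ {B} → B ⊑ (single g ◂ shift p (A X)) →
               (∀ {D} → Closed D → Supp (suc p + w) h D → B ⊑ D → ¬ _) → shift (suc p) (S X) ⊑ B
  essential′ {B} B⊑A none (suc j) i e with j′ , refl , e′ ← shift-true p j i e =
    essential X (λ j i b → trans (sym (shift-+ p j i)) (B⊑A (suc p + j) i b)) none′ j′ i e′
    where
    none′ : ∀ {C} → Closed C → Supp w h C → (λ j → B (suc p + j)) ⊑ C → ¬ _
    none′ {C} c s B⊑C k with D , cD , sD , e , C⊑D , kD ← certify c s k = none cD sD B⊑D kD
      where
      B⊑D : B ⊑ D
      B⊑D zero    i b with refl ← single⇒≡ i (B⊑A 0 i b) = e
      B⊑D (suc j) i b with j′ , refl , _ ← shift-true p j i (B⊑A (suc j) i b) =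
        C⊑D j′ i (B⊑C j′ i b)

search : ∀ n (x : ℕ → Bool) → (∃ λ i → i < n × x i ≡ false) ⊎ FullColumn n x
search zero    x = inj₂ λ ()
search (suc n) x with x 0 in e | search n (x ∘ suc)
... | false | _                     = inj₁ (0 , s≤s z≤n , e)
... | true  | inj₁ (i , i<n , e′)   = inj₁ (suc i , s≤s i<n , e′)
... | true  | inj₂ full             = inj₂ λ { {zero} _ → e ; {suc i} (s≤s p) → full p }

module _ {w h s : ℕ} where

  private
    W = suc w
    H = suc (suc h)
    top<H : 0 < H
    top<H = s≤s z≤n
    bottom : ℕ
    bottom = suc h

  pad : System (Hole W H) W H s → System (Hole (2 + W) H) (2 + W) H s
  pad = prepend 1 0 top<H (λ c e → grow₂ c top<H e (s≤s z≤n))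
    λ { {C} c s (j , i , j<w , i<h , e) → extend C , closed-extend c , supp-extend s , refl ,
        (λ _ _ → id) , 2 + j , i , s≤s (s≤s j<w) , i<h , e }

  testColumn : System (Hole W H) W H s →
               System (λ D → CellFree bottom D ⊎ (FullColumn H (D 0) × RowHole (2 + W) D)) (2 + W) H s
  testColumn = prepend 1 0 top<H (λ c e → grow₂ c top<H e (s≤s z≤n))
    λ {C} c s k → extend C , closed-extend c , supp-extend s , refl , (λ _ _ → id) , cert c k
    where
    cert : ∀ {C} → Closed C → Hole W H C →
           CellFree bottom (extend C) ⊎ (FullColumn H (extend C 0) × RowHole (2 + W) (extend C))
    cert {C} c (j , i , j<w , i<h , e) with prefix (C 0) bottom in eq | search W (λ j → C j 0)
    ... | false | _ = inj₁ refl
    ... | true  | inj₁ (j′ , j′<w , e′) =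
      inj₂ (full-addTop-prefix eq , 2 + j′ , s≤s (s≤s j′<w) , e′)
    ... | true  | inj₂ row = ⊥-elim (true≢false
      (spread-all c (λ {i} i<h → prefix⇒ {C 0} i (prefix-down (s≤s⁻¹ i<h) eq)) top<H row j<w i<h) e)

  testRow : System (λ D → CellFree bottom D ⊎ (FullColumn H (D 0) × RowHole W D)) W H s →
            System (RowHole (2 + W)) (2 + W) H s
  testRow = prepend 1 bottom ≤-refl (λ c e → grow₂ c ≤-refl e (s≤s z≤n))
    λ { {C} c s (inj₁ e) → single bottom ◂ ∅ ◂ C , closed-guard c e , supp-guard ≤-refl s ,
          single-self bottom , (λ _ _ → id) , 1 , s≤s (s≤s z≤n) , refl
      ; {C} c s (inj₂ (full , j , j<w , e)) → extend C , closed-extend c , supp-extend s ,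
          prefix-full bottom full , (λ _ _ → id) , 2 + j , s≤s (s≤s j<w) , e }

  freeCorner : System (ColumnHole H) W H s → System (CellFree bottom) (2 + W) H s
  freeCorner = prepend 1 0 top<H (λ c e → grow₂ c top<H e (s≤s z≤n))
    λ {C} c s k → extend C , closed-extend c , supp-extend s , refl , (λ _ _ → id) , cert {C} k
    where
    cert : ∀ {C} → ColumnHole H C → prefix (C 0) bottom ≡ false
    cert {C} (i , i<h , e) with prefix (C 0) bottom in eq
    ... | false = refl
    ... | true  = ⊥-elim (true≢false (prefix⇒ i (prefix-down (s≤s⁻¹ i<h) eq)) e)

  guardBottom : System (CellFree bottom) W H s → System (Guarded bottom) (2 + W) H s
  guardBottom = prepend 1 bottom ≤-refl (λ c e → grow₂ c ≤-refl e (s≤s z≤n))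
    λ {C} c s e → single bottom ◂ ∅ ◂ C , closed-guard c e , supp-guard ≤-refl s ,
      single-self bottom , (λ _ _ → id) , (λ _ → refl) , λ i → single⇒≡ i

  guardTop : System (Guarded bottom) W H s → System (Guarded 0) (2 + W) H s
  guardTop = prepend 1 0 top<H (λ c e → grow₂ c top<H e (s≤s z≤n))
    λ {C} c s k → single 0 ◂ ∅ ◂ C , closed-guard c (free {C} k) , supp-guard top<H s ,
      refl , (λ _ _ → id) , (λ _ → refl) , λ i → single⇒≡ i
    where
    free : ∀ {C} → Guarded bottom C → C 0 0 ≡ false
    free {C} (_ , at) with C 0 0 in e
    ... | false = refl
    ... | true with () ← at 0 e

-- One column only, to correct the parity of the width.
padOdd : ∀ {w h s} → System (Guarded (2 + h)) (2 + w) (3 + h) s →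
         System (Hole (3 + w) (3 + h)) (3 + w) (3 + h) s
padOdd = prepend 0 0 (s≤s z≤n) (λ c e → grow₁ c (s≤s z≤n) e (s≤s z≤n))
  λ {C} c s k → single 0 ◂ C , closed′ c k , supp′ s , refl , (λ _ _ → id) ,
    2 , 0 , s≤s (s≤s (s≤s z≤n)) , s≤s z≤n , proj₁ k 0
  where
  closed′ : ∀ {h C} → Closed C → Guarded (2 + h) C → Closed (single 0 ◂ C)
  closed′ c (empty , at) = closed-◂
    (λ { _ _ () })
    (compatible (λ { zero _ q → case at 1 q of λ () }) (λ { _ () }))
    (λ i _ q → ⊥-elim (true≢false q (empty i)))
    c
  supp′ : ∀ {w h C} → Supp w (suc h) C → Supp (suc w) (suc h) (single 0 ◂ C)
  supp′ s zero    i e with refl ← single⇒≡ i e = s≤s z≤n , s≤s z≤n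
  supp′ s (suc j) i e = s≤s (proj₁ (s j i e)) , proj₂ (s j i e)

guard : ∀ {w h s} → System (Hole (2 + w) (2 + h)) (2 + w) (2 + h) s →
        System (Guarded (5 + h)) (6 + w) (6 + h) s
guard X = guardBottom (freeCorner (transpose id (testRow (testColumn (transpose hole X)))))
  where
  hole : ∀ {w h C} → Hole h w C → Hole w h (flip C)
  hole (j , i , j<h , i<w , e) = i , j , i<w , j<h , e

-- Two-sided planes

-- (l , r) stands for the plane over ℤ whose columns 0, 1, … are those of r and whose
-- columns -1, -2, … are those of l.
Zipper : Set
Zipper = Plane × Plane

infix 4 _⊑²_

_⊑²_ : Zipper → Zipper → Set
(l , r) ⊑² (l′ , r′) = (l ⊑ l′) × (r ⊑ r′)

record ClosedZipper (z : Zipper) : Set where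
  constructor closedZipper
  private
    l = proj₁ z
    r = proj₂ z
  field
    closedˡ : Closed l
    closedʳ : Closed r
    across  : Compatible (l 0) (r 0)
    horizˡ  : HClosed (l 1) (l 0) (r 0)
    horizʳ  : HClosed (l 0) (r 0) (r 1)

open ClosedZipper

left₁ right₁ : Zipper → Zipper
left₁  (l , r) = l ∘ suc , (l 0 ◂ r)
right₁ (l , r) = (r 0 ◂ l) , r ∘ suc

left right : ℕ → Zipper → Zipper
left  zero    z = z
left  (suc n) z = left n (left₁ z)
right zero    z = z
right (suc n) z = right₁ (right n z)

closed-swap : ∀ {z} → ClosedZipper z → ClosedZipper (swap z)
closed-swap c = closedZipper (closedʳ c) (closedˡ c) (compatible-sym (across c))
  (λ i p q → horizʳ c i q p) (λ i p q → horizˡ c i q p)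

closed-left₁ : ∀ {z} → ClosedZipper z → ClosedZipper (left₁ z)
closed-left₁ c = closedZipper
  (closed-tail (closedˡ c))
  (closed-◂ (vert (closedˡ c) 0) (across c) (horizʳ c) (closedʳ c))
  (compatible-sym (adjac (closedˡ c) 0))
  (λ i p q → horiz (closedˡ c) 0 i q p)
  (horizˡ c)

closed-left : ∀ n {z} → ClosedZipper z → ClosedZipper (left n z)
closed-left zero    c = c
closed-left (suc n) c = closed-left n (closed-left₁ c)

closed-right : ∀ n {z} → ClosedZipper z → ClosedZipper (right n z)
closed-right zero    c = c
closed-right (suc n) c = closed-swap (closed-left₁ (closed-swap (closed-right n c)))

⊑-right : ∀ n {a z} → left n a ⊑² z → a ⊑² right n z
⊑-right zero    p = p
⊑-right (suc n) p with pl , pr ← ⊑-right n p =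
  (λ { zero → pr 0 ; (suc j) → pl j }) , λ j → pr (suc j)

left-⊑ : ∀ n {a z} → a ⊑² right n z → left n a ⊑² z
left-⊑ zero    p         = p
left-⊑ (suc n) (pl , pr) = left-⊑ n ((λ j → pl (suc j)) , λ { zero → pl 0 ; (suc j) → pr j })

⊑-left : ∀ n {a z} → right n z ⊑² a → z ⊑² left n a
⊑-left zero    p         = p
⊑-left (suc n) (pl , pr) = ⊑-left n ((λ j → pl (suc j)) , λ { zero → pl 0 ; (suc j) → pr j })

right-⊑ : ∀ n {a z} → z ⊑² left n a → right n z ⊑² a
right-⊑ zero    p = p
right-⊑ (suc n) p with pl , pr ← right-⊑ n p =
  (λ { zero → pr 0 ; (suc j) → pl j }) , λ j → pr (suc j)

full-right : ∀ n {w h z} → Full n h (proj₁ (right n z)) → Full w h (proj₂ (right n z)) →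
             Full (n + w) h (proj₂ z)
full-right zero    fl fr = fr
full-right (suc n) {w} {h} {z} fl fr = subst (λ m → Full m h (proj₂ z)) (+-suc n w)
  (full-right n (λ p → fl (s≤s p)) λ { {zero} _ → fl (s≤s z≤n) ; {suc j} (s≤s p) → fr p })

supp-left : ∀ n {w h l r} → Supp n h l → Supp w h r →
            Supp 0 h (proj₁ (left n (l , r))) × Supp (n + w) h (proj₂ (left n (l , r)))
supp-left zero    sl sr = sl , sr
supp-left (suc n) {w} {h} {l} {r} sl sr
  with p , q ← supp-left n {suc w} {h} {l ∘ suc} {l 0 ◂ r}
         (λ j i e → s≤s⁻¹ (proj₁ (sl (suc j) i e)) , proj₂ (sl (suc j) i e))
         (λ { zero i e → s≤s z≤n , proj₂ (sl 0 i e)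
            ; (suc j) i e → s≤s (proj₁ (sr j i e)) , proj₂ (sr j i e) })
  = p , subst (λ m → Supp m h (proj₂ (left n (l ∘ suc , (l 0 ◂ r))))) (+-suc n w) q

count-left : ∀ n w h l r → count (n + w) h (proj₂ (left n (l , r))) ≡ count n h l + count w h r
count-left zero    w h l r = refl
count-left (suc n) w h l r = begin
  count (suc (n + w)) h f                         ≡⟨ cong (λ m → count m h f) (sym (+-suc n w)) ⟩
  count (n + suc w) h f                           ≡⟨ count-left n (suc w) h (l ∘ suc) (l 0 ◂ r) ⟩
  count n h (l ∘ suc) + (c + count w h r)         ≡⟨ sym (+-assoc (count n h (l ∘ suc)) c _) ⟩
  count n h (l ∘ suc) + c + count w h r           ≡⟨ cong (_+ count w h r) (+-comm _ c) ⟩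
  count (suc n) h l + count w h r                 ∎
  where
  open ≡-Reasoning
  f = proj₂ (left n (l ∘ suc , (l 0 ◂ r)))
  c = sumTo h (boolToℕ ∘ l 0)

left-+ : ∀ n {l r} j → proj₂ (left n (l , r)) (n + j) ≡ r j
left-+ zero            j = refl
left-+ (suc n) {l} {r} j = trans (cong (proj₂ (left n (left₁ (l , r)))) (sym (+-suc n j)))
                                 (left-+ n {l ∘ suc} {l 0 ◂ r} (suc j))

-- Joining two guarded systems

box : ℕ → ℕ → Plane
box w h j i = (j <ᵇ w) ∧ (i <ᵇ h)

<ᵇ-true : ∀ {m n} → (m <ᵇ n) ≡ true → m < n
<ᵇ-true {m} {n} e = <ᵇ⇒< m n (Equivalence.from T-≡ e)

true-<ᵇ : ∀ {m n} → m < n → (m <ᵇ n) ≡ true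
true-<ᵇ p = Equivalence.to T-≡ (<⇒<ᵇ p)

supp-box : ∀ w h → Supp w h (box w h)
supp-box w h j i e with p , q ← ∧-true {j <ᵇ w} e = <ᵇ-true p , <ᵇ-true q

full-box : ∀ {w h j i} → j < w → i < h → box w h j i ≡ true
full-box p q = cong₂ _∧_ (true-<ᵇ p) (true-<ᵇ q)

closed-box : ∀ w h → Closed (box w h)
closed-box w h = closed
  (λ j i _ q → full-box (proj₁ (sp j _ q)) (<⇒≤ (proj₂ (sp j _ q))))
  (λ j → compatible
    (λ i p q → full-box (proj₁ (sp j _ p)) (proj₂ (sp _ _ q)) ,
               full-box (proj₁ (sp _ _ q)) (proj₂ (sp j i p)))
    (λ i p q → full-box (proj₁ (sp j _ p)) (proj₂ (sp _ i q)) ,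
               full-box (proj₁ (sp _ i q)) (proj₂ (sp j _ p))))
  (λ j i _ q → full-box (<⇒≤ (proj₁ (sp _ i q))) (proj₂ (sp _ i q)))
  where sp = supp-box w h

lower : Plane → Plane
lower f j zero          = false
lower f j (suc zero)    = false
lower f j (suc (suc i)) = f j i

raise : Plane → Plane
raise f j i = f j (2 + i)

closed-lower : ∀ {f} → Closed f → Closed (lower f)
closed-lower c = closed
  (λ { j (suc (suc i)) → vert c j i })
  (λ j → compatible (λ { (suc (suc i)) → diag (adjac c j) i })
                    (λ { zero _ () ; (suc zero) _ () ; (suc (suc i)) → anti (adjac c j) i }))
  (λ { j (suc (suc i)) → horiz c j i })

closed-raise : ∀ {f} → Closed f → Closed (raise f)
closed-raise c = closed
  (λ j i → vert c j (2 + i))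
  (λ j → compatible (λ i → diag (adjac c j) (2 + i)) (λ i → anti (adjac c j) (2 + i)))
  (λ j i → horiz c j (2 + i))

supp-lower : ∀ {w h f} → Supp w h f → Supp w (2 + h) (lower f)
supp-lower s j (suc (suc i)) e = proj₁ (s j i e) , s≤s (s≤s (proj₂ (s j i e)))

supp-taller : ∀ {w h f} → Supp w h f → Supp w (2 + h) f
supp-taller s j i e = proj₁ (s j i e) , ≤-trans (proj₂ (s j i e)) (m≤n+m _ 2)

module Join {w₁ w₂ h s₁ s₂ : ℕ}
  (X : System (Guarded (suc h)) (suc w₁) (2 + h) s₁)
  (Y : System (Guarded 0) (2 + w₂) (2 + h) s₂) where

  private
    W₁ = suc w₁
    W₂ = 2 + w₂
    H  = 2 + h
    union : Plane → Plane → Plane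
    union f g = proj₂ (left W₁ (lower f , g))

    closed-union : ∀ {f g} → ClosedZipper (lower f , g) → Closed (union f g)
    closed-union c = closedʳ (closed-left W₁ c)

    supp-union : ∀ {f g} → Supp W₁ H f → Supp W₂ H g → Supp (W₁ + W₂) (2 + H) (union f g)
    supp-union sf sg = proj₂ (supp-left W₁ (supp-lower sf) (supp-taller sg))

    zipper : Plane → Zipper
    zipper B = right W₁ ((λ _ → ∅) , B)

    -- The left part is lowered by two rows, so that its guarding cell lies below the right box
    -- and the guarding cell of the right part above the left box.
    closedˡ-guarded : ∀ {f} → Closed f → Guarded (suc h) f → ClosedZipper (lower f , box W₂ H)
    closedˡ-guarded {f} c (empty , at) = closedZipper (closed-lower c) (closed-box W₂ H)
      (compatible
        (λ { (suc (suc i)) p q → ⊥-elim (far (<⇒≤ (<⇒≤ (s≤s⁻¹ (proj₂ (supp-box W₂ H 0 (3 + i) q))))) (at i p)) })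
        (λ { (suc i) p q → ⊥-elim (far (s≤s⁻¹ (proj₂ (supp-box W₂ H 0 (suc i) q))) (at i p)) }))
      (λ { (suc (suc i)) p _ → ⊥-elim (true≢false p (empty i)) })
      (λ i _ q → q)
      where
      far : ∀ {i} → i < suc h → i ≡ suc h → ⊥
      far p refl = <-irrefl refl p

    closedʳ-guarded : ∀ {g} → Closed g → Guarded 0 g → ClosedZipper (lower (box W₁ H) , g)
    closedʳ-guarded {g} c (empty , at) = closedZipper (closed-lower (closed-box W₁ H)) c
      (compatible
        (λ { (suc (suc i)) _ q → case at (3 + i) q of λ () })
        (λ { (suc i) _ q → case at (suc i) q of λ () }))
      (λ { (suc (suc i)) p _ → full-box {W₁} {H} {0} (s≤s z≤n) (proj₂ (supp-box W₁ H 1 i p)) })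
      (λ i _ q → ⊥-elim (true≢false q (empty i)))

    contained : ∀ {B f g} → zipper B ⊑² (lower f , g) → B ⊑ union f g
    contained p = proj₂ (⊑-left W₁ p)

    free : ∀ {f g} j i → g j i ≡ false → union f g (W₁ + j) i ≡ false
    free {f} {g} j i e = trans (cong (λ x → x i) (left-+ W₁ {lower f} {g} j)) e

    percolates′ : ∀ {C} → Closed C → union (A X) (A Y) ⊑ C → Full (W₁ + W₂) (2 + H) C
    percolates′ {C} c A⊑C = full-right W₁ {z = (λ _ → ∅) , C}
      (spread-all (closedˡ z) fullˡ (s≤s (s≤s (s≤s z≤n))) (λ p → fillˡ p (s≤s z≤n)))
      (spread-all (closedʳ z) fullʳ (s≤s z≤n) (λ p → fillʳ p (s≤s z≤n)))
      where
      l = proj₁ (zipper C)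
      r = proj₂ (zipper C)
      z : ClosedZipper (zipper C)
      z = closed-right W₁ (closedZipper
        (closed (λ _ _ ()) (λ _ → compatible (λ _ ()) (λ _ ())) (λ _ _ ())) c
        (compatible (λ _ ()) (λ _ ())) (λ _ ()) (λ _ ()))
      above : (lower (A X) , A Y) ⊑² zipper C
      above = ⊑-right W₁
        ((λ j i e → case proj₁ (proj₁ (supp-left W₁ (supp-lower (supported X)) (supp-taller (supported Y))) j i e) of λ ())
        , A⊑C)
      fillˡ : Full W₁ H (raise l)
      fillˡ = percolates X (closed-raise (closedˡ z)) (λ j i → proj₁ above j (2 + i))
      fillʳ : Full W₂ H r
      fillʳ = percolates Y (closedʳ z) (proj₂ above)
      l₁ : l 0 1 ≡ true
      l₁ = proj₁ (anti (across z) 1 (fillˡ (s≤s z≤n) (s≤s z≤n)) (fillʳ (s≤s z≤n) (s≤s (s≤s z≤n))))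
      fullˡ : FullColumn (2 + H) (l 0)
      fullˡ {zero}        _               = proj₁ (anti (across z) 0 l₁ (fillʳ (s≤s z≤n) (s≤s z≤n)))
      fullˡ {suc zero}    _               = l₁
      fullˡ {suc (suc i)} (s≤s (s≤s i<h)) = fillˡ (s≤s z≤n) i<h
      fullʳ : FullColumn (2 + H) (r 0)
      fullʳ = spread (across z) fullˡ (s≤s z≤n) (fillʳ (s≤s z≤n) (s≤s z≤n))

    essential′ : ∀ {B} → B ⊑ union (A X) (A Y) →
      (∀ {C} → Closed C → Supp (W₁ + W₂) (2 + H) C → B ⊑ C → ¬ Hole (W₁ + W₂) (2 + H) C) →
      union (S X) (S Y) ⊑ B
    essential′ {B} B⊑A none = proj₂ (left-⊑ W₁ {z = (λ _ → ∅) , B} (lowerS , essentialʳ))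
      where
      l = proj₁ (zipper B)
      r = proj₂ (zipper B)
      below : zipper B ⊑² (lower (A X) , A Y)
      below = right-⊑ W₁ ((λ _ _ ()) , B⊑A)
      essentialˡ : S X ⊑ raise l
      essentialˡ = essential X (λ j i → proj₁ below j (2 + i)) λ {C} c s l⊑C k →
        none (closed-union (closedˡ-guarded c k)) (supp-union s (supp-box W₂ H))
          (contained ((λ { j zero e → proj₁ below j 0 e
                         ; j (suc zero) e → proj₁ below j 1 e
                         ; j (suc (suc i)) → l⊑C j i })
                     , λ j i e → full-box (proj₁ (supported Y j i (proj₂ below j i e)))
                                          (proj₂ (supported Y j i (proj₂ below j i e)))))
          (W₁ + 0 , H , +-monoʳ-< W₁ (s≤s z≤n) , s≤s (n≤1+n H) ,
            free {C} 0 H (n≮n⇒ H))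
        where
        n≮n⇒ : ∀ n → (n <ᵇ n) ≡ false
        n≮n⇒ zero    = refl
        n≮n⇒ (suc n) = n≮n⇒ n
      essentialʳ : S Y ⊑ r
      essentialʳ = essential Y (proj₂ below) λ {C} c s r⊑C k →
        none (closed-union (closedʳ-guarded c k)) (supp-union (supp-box W₁ H) s)
          (contained ((λ { j zero e → proj₁ below j 0 e
                         ; j (suc zero) e → proj₁ below j 1 e
                         ; j (suc (suc i)) e → full-box (proj₁ (supported X j i (proj₁ below j (2 + i) e)))
                                                        (proj₂ (supported X j i (proj₁ below j (2 + i) e))) })
                     , r⊑C))
          (W₁ + 1 , 0 , +-monoʳ-< W₁ (s≤s (s≤s z≤n)) , s≤s z≤n ,
            free {box W₁ H} {C} 1 0 (proj₁ k 0))
      lowerS : lower (S X) ⊑ l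
      lowerS j (suc (suc i)) e = essentialˡ j i e

  join : System (Hole (W₁ + W₂) (2 + H)) (W₁ + W₂) (2 + H) (s₁ + s₂)
  join = record
    { A          = union (A X) (A Y)
    ; S          = union (S X) (S Y)
    ; supported  = supp-union (supported X) (supported Y)
    ; percolates = percolates′
    ; essential  = essential′
    ; size       = subst (s₁ + s₂ ≤_) (sym (count-left W₁ W₂ (2 + H) (lower (S X)) (S Y)))
                     (+-mono-≤ (size X)
                       (≤-trans (size Y) (sumTo-mono W₂ (λ j → sumTo-monoˡ {a = boolToℕ ∘ S Y j} (m≤n+m H 2)))))
    }

merge : ∀ {w₁ w₂ h s₁ s₂} →
        System (Hole (2 + w₁) (2 + h)) (2 + w₁) (2 + h) s₁ →
        System (Hole (2 + w₂) (2 + h)) (2 + w₂) (2 + h) s₂ →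
        System (Hole (6 + w₁ + (8 + w₂)) (8 + h)) (6 + w₁ + (8 + w₂)) (8 + h) (s₁ + s₂)
merge X Y = Join.join (guard X) (guardTop (guard Y))

-- Superadditivity

Spanning : ℕ → ℕ → ℕ → Set
Spanning w h s = System (Hole w h) w h s

transposeˢ : ∀ {w h s} → Spanning w h s → Spanning h w s
transposeˢ = transpose λ (j , i , j<w , i<h , e) → i , j , i<h , j<w , e

resize : ∀ {w w′ h h′ s s′} → w ≡ w′ → h ≡ h′ → s ≡ s′ → Spanning w h s → Spanning w′ h′ s′
resize refl refl refl X = X

pads : ∀ n {w h s} → Spanning (2 + w) (2 + h) s → Spanning (n * 2 + (2 + w)) (2 + h) s
pads zero    X = X
pads (suc n) {w} {h} {s} X =
  resize (cong (2 +_) (sym e)) refl refl (pad (resize e refl refl (pads n X)))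
  where
  e : n * 2 + (2 + w) ≡ suc (suc (n * 2 + w))
  e = trans (+-suc _ _) (cong suc (+-suc _ _))

padBoth : ∀ n {m s} → Spanning (2 + m) (2 + m) s → Spanning (n * 2 + (2 + m)) (n * 2 + (2 + m)) s
padBoth n {m} X =
  resize (sym e) refl refl (transposeˢ (pads n (transposeˢ (resize e refl refl (pads n X)))))
  where
  e : n * 2 + (2 + m) ≡ 2 + (n * 2 + m)
  e = trans (+-suc _ _) (cong suc (+-suc _ _))

padNine : ∀ {m s} → Spanning (2 + m) (2 + m) s → Spanning (11 + m) (11 + m) s
padNine X = transposeˢ (padOdd (guard (transposeˢ (padOdd (guard X)))))

module Tiling (k s : ℕ) where

  -- The side of a row of 1 + a tiles, each of side 2 + k. One merging in each direction turns
  -- sides x, y into x + y + 16 or x + y + 22, so 28 a + 6 is enough room for all margins.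
  side : ℕ → ℕ
  side a = 8 + (k + a * (30 + k))

  Block : ℕ → ℕ → Set
  Block a b = Spanning (side a) (side b) (suc a * suc b * s)

  transposeᵇ : ∀ {a b} → Block a b → Block b a
  transposeᵇ {a} {b} X = resize refl refl (cong (_* s) (*-comm (suc a) (suc b))) (transposeˢ X)

  quad : ∀ a a′ b b′ {c d} → suc (a + a′) ≡ c → suc (b + b′) ≡ d →
         Block a b → Block a′ b → Block a b′ → Block a′ b′ → Block c d
  quad a a′ b b′ refl refl X₁ X₂ X₃ X₄ =
    resize
      (solve 3 (λ k a a′ →
         con 24 :+ (k :+ a :* (con 30 :+ k) :+ (con 14 :+ (k :+ a′ :* (con 30 :+ k)))) :=
         con 8 :+ (k :+ (con 1 :+ (a :+ a′)) :* (con 30 :+ k))) refl k a a′)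
      (solve 3 (λ k b b′ →
         con 18 :+ ((k :+ b :* (con 30 :+ k)) :+ (con 20 :+ (k :+ b′ :* (con 30 :+ k)))) :=
         con 8 :+ (k :+ (con 1 :+ (b :+ b′)) :* (con 30 :+ k))) refl k b b′)
      (solve 5 (λ s a a′ b b′ →
         (con 1 :+ a) :* (con 1 :+ b) :* s :+ (con 1 :+ a′) :* (con 1 :+ b) :* s :+
         ((con 1 :+ a) :* (con 1 :+ b′) :* s :+ (con 1 :+ a′) :* (con 1 :+ b′) :* s) :=
         (con 2 :+ (a :+ a′)) :* (con 2 :+ (b :+ b′)) :* s) refl s a a′ b b′)
      (pads 3 (transposeˢ both))
    where
    both = merge (transposeˢ (merge X₁ X₂)) (transposeˢ (merge X₃ X₄))

  Blocks : ℕ → Set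
  Blocks q = Block q q × Block q (suc q) × Block (suc q) (suc q)

  blocks : Spanning (2 + k) (2 + k) s → ∀ q → Blocks q
  blocks X q = subst Blocks (toℕ-fromℕ q) (go (toBinary q))
    where
    one : Block 0 0
    one = resize (cong (8 +_) (sym (+-identityʳ k))) (cong (8 +_) (sym (+-identityʳ k)))
      (sym (+-identityʳ s)) (padBoth 3 X)

    two : Block 0 1
    two = resize (cong (8 +_) (sym (+-identityʳ k)))
      (solve 1 (λ k → con 30 :+ (k :+ (con 8 :+ k)) := con 8 :+ (k :+ con 1 :* (con 30 :+ k))) refl k)
      (cong (s +_) (sym (+-identityʳ s)))
      (transposeˢ (pads 12 (merge X X)))

    odd : ∀ v → Blocks v → Blocks (suc (v + v))
    odd v (X , Y , Z) =
      quad v v v v refl refl X X X X ,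
      quad v v v (suc v) refl e X X Y Y ,
      quad v (suc v) v (suc v) e e X (transposeᵇ {v} {suc v} Y) Y Z
      where
      e : suc (v + suc v) ≡ suc (suc (v + v))
      e = cong suc (+-suc v v)

    even : ∀ v → Blocks v → Blocks (suc (suc (v + v)))
    even v (X , Y , Z) =
      quad v (suc v) v (suc v) e e X (transposeᵇ {v} {suc v} Y) Y Z ,
      quad v (suc v) (suc v) (suc v) e (cong suc e) Y Z Y Z ,
      quad (suc v) (suc v) (suc v) (suc v) (cong suc e) (cong suc e) Z Z Z Z
      where
      e : suc (v + suc v) ≡ suc (suc (v + v))
      e = cong suc (+-suc v v)

    go : ∀ n → Blocks (fromBinary n)
    go 0ᵇ       = one , two , quad 0 0 0 0 refl refl one one one one
    go 2[1+ n ] = subst Blocks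
      (solve 1 (λ v → con 2 :+ (v :+ v) := con 2 :* (con 1 :+ v)) refl (fromBinary n))
      (even (fromBinary n) (go n))
    go 1+[2 n ] = subst Blocks
      (cong (λ m → suc (fromBinary n + m)) (sym (+-identityʳ (fromBinary n)))) (odd (fromBinary n) (go n))

halve : ∀ n → (∃ λ m → n ≡ m * 2) ⊎ (∃ λ m → n ≡ suc (m * 2))
halve zero    = inj₁ (0 , refl)
halve (suc n) with halve n
... | inj₁ (m , refl) = inj₂ (m , refl)
... | inj₂ (m , refl) = inj₁ (suc m , refl)

tile : ∀ {k s} q r → Spanning (2 + k) (2 + k) s →
       let N = suc q * (30 + k) + r in Spanning N N (suc q * suc q * s)
tile {k} {s} q r X with halve r
... | inj₁ (m , refl) = resize e e refl (padBoth (11 + m) B)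
  where
  B = proj₁ (Tiling.blocks k s X q)
  e : (11 + m) * 2 + Tiling.side k s q ≡ suc q * (30 + k) + m * 2
  e = solve 3 (λ m k q → (con 11 :+ m) :* con 2 :+ (con 8 :+ (k :+ q :* (con 30 :+ k))) :=
                         (con 1 :+ q) :* (con 30 :+ k) :+ m :* con 2) refl m k q
... | inj₂ (m , refl) = resize e e refl (padBoth (7 + m) (padNine B))
  where
  B = proj₁ (Tiling.blocks k s X q)
  e : (7 + m) * 2 + (9 + Tiling.side k s q) ≡ suc q * (30 + k) + suc (m * 2)
  e = solve 3 (λ m k q → (con 7 :+ m) :* con 2 :+ (con 17 :+ (k :+ q :* (con 30 :+ k))) :=
                         (con 1 :+ q) :* (con 30 :+ k) :+ (con 1 :+ m :* con 2)) refl m k q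

module _ {X : Set} where

  sum-mono : ∀ {f g : X → ℕ} xs → (∀ x → f x ≤ g x) → sum (map f xs) ≤ sum (map g xs)
  sum-mono []       f≤g = z≤n
  sum-mono (x ∷ xs) f≤g = +-mono-≤ (f≤g x) (sum-mono xs f≤g)

  sum-mono-< : ∀ {f g : X → ℕ} {xs x} → (∀ x → f x ≤ g x) → x ∈ xs → f x < g x →
               sum (map f xs) < sum (map g xs)
  sum-mono-< {xs = _ ∷ xs} f≤g (here refl) f<g = +-mono-<-≤ f<g (sum-mono xs f≤g)
  sum-mono-< {xs = y ∷ _}  f≤g (there x∈)  f<g = +-mono-≤-< (f≤g y) (sum-mono-< f≤g x∈ f<g)

  1≤sum : ∀ {f : X → Bool} {xs x} → x ∈ xs → f x ≡ true → 1 ≤ sum (map (boolToℕ ∘ f) xs)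
  1≤sum (here refl) e rewrite e = s≤s z≤n
  1≤sum {f} {y ∷ _} (there x∈)  e = m≤n⇒m≤o+n (boolToℕ (f y)) (1≤sum x∈ e)

  2≤sum : ∀ {f : X → Bool} {xs x y} → x ∈ xs → y ∈ xs → ¬ x ≡ y → f x ≡ true → f y ≡ true →
          2 ≤ sum (map (boolToℕ ∘ f) xs)
  2≤sum (here refl) (here refl) x≢y _  _  = ⊥-elim (x≢y refl)
  2≤sum (here refl) (there y∈)  _   ex ey rewrite ex = s≤s (1≤sum y∈ ey)
  2≤sum (there x∈)  (here refl) _   ex ey rewrite ey = s≤s (1≤sum x∈ ex)
  2≤sum {f} {z ∷ _} (there x∈)  (there y∈)  x≢y ex ey =
    m≤n⇒m≤o+n (boolToℕ (f z)) (2≤sum x∈ y∈ x≢y ex ey)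

  1≤sum⁻ : ∀ (f : X → Bool) xs → 1 ≤ sum (map (boolToℕ ∘ f) xs) → ∃ λ x → x ∈ xs × f x ≡ true
  1≤sum⁻ f (x ∷ xs) p with f x in e
  ... | true  = x , here refl , e
  ... | false with y , y∈ , ey ← 1≤sum⁻ f xs p = y , there y∈ , ey

  2≤sum⁻ : ∀ (f : X → Bool) {xs} → Unique xs → 2 ≤ sum (map (boolToℕ ∘ f) xs) →
           ∃₂ λ x y → ¬ x ≡ y × f x ≡ true × f y ≡ true
  2≤sum⁻ f {x ∷ xs} (x∉ ∷ u) p with f x in e
  ... | true  with y , y∈ , ey ← 1≤sum⁻ f xs (s≤s⁻¹ p) = x , y , lookup x∉ y∈ , e , ey
  ... | false = 2≤sum⁻ f u p

-- The grid

allVertices≡ : ∀ m n → allVertices m n ≡ cartesianProduct (allFin m) (allFin n)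
allVertices≡ m n = go (allFin m)
  where
  go : ∀ (is : List (Fin m)) →
       concatMap (λ i → map (λ j → (i , j)) (allFin n)) is ≡ cartesianProduct is (allFin n)
  go []       = refl
  go (i ∷ is) = cong (map (i ,_) (allFin n) ++_) (go is)

∈-allVertices : ∀ {m n} (v : Vertex m n) → v ∈ allVertices m n
∈-allVertices {m} {n} (i , j) =
  subst ((i , j) ∈_) (sym (allVertices≡ m n)) (∈-cartesianProduct⁺ (∈-allFin i) (∈-allFin j))

unique-allVertices : ∀ m n → Unique (allVertices m n)
unique-allVertices m n =
  subst Unique (sym (allVertices≡ m n)) (cartesianProduct⁺ (allFin⁺ m) (allFin⁺ n))

sum-allFin : ∀ n {f : Fin n → ℕ} {a : ℕ → ℕ} → (∀ i → f i ≡ a (toℕ i)) →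
             sum (map f (allFin n)) ≡ sumTo n a
sum-allFin n {f} e = trans (cong sum (map-tabulate {n = n} id f)) (go n e)
  where
  go : ∀ n {f : Fin n → ℕ} {a : ℕ → ℕ} → (∀ i → f i ≡ a (toℕ i)) → sum (tabulate f) ≡ sumTo n a
  go zero    e = refl
  go (suc n) e = cong₂ _+_ (e Fin.zero) (go n (e ∘ Fin.suc))

sum-concatMap : ∀ {X Y : Set} (f : Y → ℕ) (g : X → List Y) xs →
                sum (map f (concatMap g xs)) ≡ sum (map (λ x → sum (map f (g x))) xs)
sum-concatMap f g []       = refl
sum-concatMap f g (x ∷ xs) = begin
  sum (map f (g x ++ concatMap g xs))                 ≡⟨ cong sum (map-++ f (g x) _) ⟩
  sum (map f (g x) ++ map f (concatMap g xs))         ≡⟨ sum-++ (map f (g x)) _ ⟩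
  sum (map f (g x)) + sum (map f (concatMap g xs))    ≡⟨ cong (sum (map f (g x)) +_) (sum-concatMap f g xs) ⟩
  sum (map (λ x → sum (map f (g x))) (x ∷ xs))        ∎
  where open ≡-Reasoning

restrict : ∀ {m n} → Plane → VSet m n
restrict f (i , j) = f (toℕ i) (toℕ j)

card-restrict : ∀ m n f → card {m} {n} (restrict f) ≡ count m n f
card-restrict m n f =
  trans (sum-concatMap (boolToℕ ∘ restrict f) (λ i → map (i ,_) (allFin n)) (allFin m))
        (sum-allFin m λ i → trans (cong sum (sym (map-∘ {g = boolToℕ ∘ restrict f} {f = i ,_} (allFin n))))
                                  (sum-allFin n λ _ → refl))

extendByFalse : ∀ {m n} → VSet m n → Plane
extendByFalse {m} {n} A j i with j <? m | i <? n
... | yes p | yes q = A (fromℕ< p , fromℕ< q)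
... | _     | _     = false

extendByFalse-true : ∀ {m n} (A : VSet m n) j i → extendByFalse A j i ≡ true →
                     ∃ λ v → A v ≡ true × toℕ (proj₁ v) ≡ j × toℕ (proj₂ v) ≡ i
extendByFalse-true {m} {n} A j i e with j <? m | i <? n
... | yes p | yes q = (fromℕ< p , fromℕ< q) , e , toℕ-fromℕ< p , toℕ-fromℕ< q
extendByFalse-true A j i () | yes _ | no _
extendByFalse-true A j i () | no _  | _

restrict-extend : ∀ {m n} (A : VSet m n) v → restrict (extendByFalse A) v ≡ A v
restrict-extend {m} {n} A (a , b) with toℕ a <? m | toℕ b <? n
... | yes p | yes q = cong₂ (λ a b → A (a , b)) (fromℕ<-toℕ a p) (fromℕ<-toℕ b q)
... | yes _ | no ¬q = ⊥-elim (¬q (toℕ<n b))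
... | no ¬p | _     = ⊥-elim (¬p (toℕ<n a))

supp-extendByFalse : ∀ {m n} (A : VSet m n) → Supp m n (extendByFalse A)
supp-extendByFalse A j i e with (a , b) , _ , refl , refl ← extendByFalse-true A j i e =
  toℕ<n a , toℕ<n b

card-extend : ∀ {m n} (A : VSet m n) → card A ≡ count m n (extendByFalse A)
card-extend {m} {n} A =
  trans (cong sum (map-cong (λ v → cong boolToℕ (sym (restrict-extend A v))) (allVertices m n)))
        (card-restrict m n (extendByFalse A))

data Neighbour : ℕ → ℕ → ℕ → ℕ → Set where
  north : ∀ {a b} → Neighbour a b a (suc b)
  south : ∀ {a b} → Neighbour a (suc b) a b
  east : ∀ {a b} → Neighbour a b (suc a) b
  west  : ∀ {a b} → Neighbour (suc a) b a b

closed-at : ∀ {f a b c d c′ d′} → Closed f → Neighbour a b c d → Neighbour a b c′ d′ →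
            ¬ (c ≡ c′ × d ≡ d′) → f c d ≡ true → f c′ d′ ≡ true → f a b ≡ true
closed-at c north north ≢ p q = ⊥-elim (≢ (refl , refl))
closed-at c south south ≢ p q = ⊥-elim (≢ (refl , refl))
closed-at c east east ≢ p q = ⊥-elim (≢ (refl , refl))
closed-at c west  west  ≢ p q = ⊥-elim (≢ (refl , refl))
closed-at c north south ≢ p q = vert c _ _ q p
closed-at c south north ≢ p q = vert c _ _ p q
closed-at c west  east ≢ p q = horiz c _ _ p q
closed-at c east west  ≢ p q = horiz c _ _ q p
closed-at c north east ≢ p q = proj₁ (anti (adjac c _) _ p q)
closed-at c east north ≢ p q = proj₁ (anti (adjac c _) _ q p)
closed-at c north west  ≢ p q = proj₂ (diag (adjac c _) _ q p)
closed-at c west  north ≢ p q = proj₂ (diag (adjac c _) _ p q)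
closed-at c south east ≢ p q = proj₁ (diag (adjac c _) _ p q)
closed-at c east south ≢ p q = proj₁ (diag (adjac c _) _ q p)
closed-at c south west  ≢ p q = proj₂ (anti (adjac c _) _ q p)
closed-at c west  south ≢ p q = proj₂ (anti (adjac c _) _ p q)

∨-true : ∀ {a b} → a ∨ b ≡ true → a ≡ true ⊎ b ≡ true
∨-true {true}  e = inj₁ refl
∨-true {false} e = inj₂ e

adj⇒neighbour : ∀ {m n} (v w : Vertex m n) → adj v w ≡ true →
                Neighbour (toℕ (proj₁ v)) (toℕ (proj₂ v)) (toℕ (proj₁ w)) (toℕ (proj₂ w))
adj⇒neighbour (a , b) (c , d) e = go (toℕ a) (toℕ b) (toℕ c) (toℕ d) e
  where
  go : ∀ a b c d →
       ((a ≡ᵇ c) ∧ dist1 b d) ∨ ((b ≡ᵇ d) ∧ dist1 a c) ≡ true → Neighbour a b c d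
  go a b c d e with ∨-true {(a ≡ᵇ c) ∧ dist1 b d} e
  ... | inj₁ p with q , r ← ∧-true {a ≡ᵇ c} p with refl ← single⇒≡ {c} a q with ∨-true {suc b ≡ᵇ d} r
  ... | inj₁ x with refl ← single⇒≡ {d} (suc b) x = north
  ... | inj₂ x with refl ← single⇒≡ {b} (suc d) x = south
  go a b c d e | inj₂ p with q , r ← ∧-true {b ≡ᵇ d} p with refl ← single⇒≡ {d} b q with ∨-true {suc a ≡ᵇ c} r
  ... | inj₁ x with refl ← single⇒≡ {c} (suc a) x = east
  ... | inj₂ x with refl ← single⇒≡ {a} (suc c) x = west

neighbour⇒adj : ∀ {m n} (v w : Vertex m n) →
                Neighbour (toℕ (proj₁ v)) (toℕ (proj₂ v)) (toℕ (proj₁ w)) (toℕ (proj₂ w)) →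
                adj v w ≡ true
neighbour⇒adj (a , b) (c , d) N = go (toℕ a) (toℕ b) (toℕ c) (toℕ d) N
  where
  go : ∀ a b c d → Neighbour a b c d →
       ((a ≡ᵇ c) ∧ dist1 b d) ∨ ((b ≡ᵇ d) ∧ dist1 a c) ≡ true
  go a b _ _ north rewrite single-self a | single-self b = refl
  go a _ _ d south rewrite single-self a | single-self d | ∨-zeroʳ (suc (suc d) ≡ᵇ d) = refl
  go a b _ _ east rewrite single-self b | single-self a = ∨-zeroʳ _
  go _ b c _ west  rewrite single-self b | single-self c | ∨-zeroʳ (suc (suc c) ≡ᵇ c) = ∨-zeroʳ _

step-closed : ∀ {m n f} {A : VSet m n} → Closed f → (∀ v → A v ≡ true → restrict f v ≡ true) →
              ∀ v → step A v ≡ true → restrict f v ≡ true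
step-closed {m} {n} {f} {A} c A⊆f v e with ∨-true {A v} e
... | inj₁ p = A⊆f v p
... | inj₂ p with x , y , x≢y , ex , ey ← 2≤sum⁻ (λ w → adj v w ∧ A w) (unique-allVertices m n)
                                            (≤ᵇ⇒≤ 2 _ (Equivalence.from T-≡ p))
  with ax , Ax ← ∧-true {adj v x} ex | ay , Ay ← ∧-true {adj v y} ey =
  closed-at c (adj⇒neighbour v x ax) (adj⇒neighbour v y ay)
    (λ (p , q) → x≢y (cong₂ _,_ (toℕ-injective p) (toℕ-injective q))) (A⊆f x Ax) (A⊆f y Ay)

iter-closed : ∀ {m n f} {A : VSet m n} → Closed f → (∀ v → A v ≡ true → restrict f v ≡ true) →
              ∀ t v → iter t A v ≡ true → restrict f v ≡ true
iter-closed c A⊆f zero    = A⊆f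
iter-closed c A⊆f (suc t) = step-closed c (iter-closed c A⊆f t)

percolates⇒full : ∀ {m n f} {A : VSet m n} → Percolates A → Closed f → extendByFalse A ⊑ f → Full m n f
percolates⇒full {f = f} {A} (t , perc) c A⊑f p q =
  subst₂ (λ j i → f j i ≡ true) (toℕ-fromℕ< p) (toℕ-fromℕ< q)
    (iter-closed c (λ v e → A⊑f _ _ (trans (restrict-extend A v) e)) t _ (perc (fromℕ< p , fromℕ< q)))

Stable : ∀ {m n} → VSet m n → Set
Stable A = ∀ v → step A v ≡ true → A v ≡ true

stable-closed : ∀ {m n} {A : VSet m n} → Stable A → Closed (extendByFalse A)
stable-closed {m} {n} {A} stable = closed
  (λ j i p q → fill (proj₁ (sp _ _ p)) (<⇒≤ (proj₂ (sp _ _ q))) south north (λ ()) p q)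
  (λ j → compatible
    (λ i p q → fill (proj₁ (sp _ _ p)) (proj₂ (sp _ _ q)) south east (λ ()) p q ,
               fill (proj₁ (sp _ _ q)) (proj₂ (sp _ _ p)) west north (λ ()) p q)
    (λ i p q → fill (proj₁ (sp _ _ p)) (proj₂ (sp _ _ q)) north east (λ ()) p q ,
               fill (proj₁ (sp _ _ q)) (proj₂ (sp _ _ p)) west south (λ ()) p q))
  (λ j i p q → fill (<⇒≤ (proj₁ (sp _ _ q))) (proj₂ (sp _ _ p)) west east (λ ()) p q)
  where
  f = extendByFalse A
  sp : Supp m n f
  sp = supp-extendByFalse A
  fill : ∀ {a b c d c′ d′} → a < m → b < n → Neighbour a b c d → Neighbour a b c′ d′ →
         ¬ (c ≡ c′ × d ≡ d′) → f c d ≡ true → f c′ d′ ≡ true → f a b ≡ true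
  fill {a} {b} {c} {d} {c′} {d′} a<m b<n N N′ distinct p q
    with x , Ax , refl , refl ← extendByFalse-true A c d p
       | y , Ay , refl , refl ← extendByFalse-true A c′ d′ q =
    subst₂ (λ j i → f j i ≡ true) (toℕ-fromℕ< a<m) (toℕ-fromℕ< b<n)
      (trans (restrict-extend A v) (stable v (trans (cong (A v ∨_) two) (∨-zeroʳ _))))
    where
    v : Vertex m n
    v = fromℕ< a<m , fromℕ< b<n
    adjacent : ∀ z → Neighbour a b (toℕ (proj₁ z)) (toℕ (proj₂ z)) → A z ≡ true → adj v z ∧ A z ≡ true
    adjacent z M Az = cong₂ _∧_ (neighbour⇒adj v z
      (subst₂ (λ j i → Neighbour j i _ _) (sym (toℕ-fromℕ< a<m)) (sym (toℕ-fromℕ< b<n)) M)) Az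
    two : (2 ≤ᵇ infectedNbrs A v) ≡ true
    two = Equivalence.to T-≡ (≤⇒≤ᵇ (2≤sum (∈-allVertices x) (∈-allVertices y)
      (λ { refl → distinct (refl , refl) }) (adjacent x N Ax) (adjacent y N′ Ay)))

card≤ : ∀ {m n} (A : VSet m n) → card A ≤ m * n
card≤ {m} {n} A = ≤-trans (≤-reflexive (card-extend A)) (sumTo-≤ m λ j → ≤-trans (sumTo-≤ n {1} λ i → bool≤1 (extendByFalse A j i)) (≤-reflexive (*-identityʳ n)))
  where
  sumTo-≤ : ∀ n {b} {a : ℕ → ℕ} → (∀ i → a i ≤ b) → sumTo n a ≤ n * b
  sumTo-≤ zero    a≤b = z≤n
  sumTo-≤ (suc n) a≤b = +-mono-≤ (a≤b 0) (sumTo-≤ n (a≤b ∘ suc))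
  bool≤1 : ∀ b → boolToℕ b ≤ 1
  bool≤1 true  = ≤-refl
  bool≤1 false = z≤n

card-mono-< : ∀ {m n} {A B : VSet m n} → A ⊂ B → card A < card B
card-mono-< {m} {n} {A} {B} (A⊆B , v , Bv , Av) =
  sum-mono-< (λ w → boolToℕ-mono (A⊆B w)) (∈-allVertices v) lt
  where
  lt : boolToℕ (A v) < boolToℕ (B v)
  lt rewrite Av | Bv = s≤s z≤n

⊆-step : ∀ {m n} {A : VSet m n} → A ⊆ step A
⊆-step v e rewrite e = refl

⊆-iter : ∀ {m n} {A : VSet m n} t → A ⊆ iter t A
⊆-iter zero    v e = e
⊆-iter (suc t) v e = ⊆-step v (⊆-iter t v e)

⊇⊎⊂ : ∀ {m n} {A B : VSet m n} → A ⊆ B → B ⊆ A ⊎ A ⊂ B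
⊇⊎⊂ {m} {n} {A} {B} A⊆B with find (allVertices m n)
  where
  find : ∀ vs → (∀ {v} → v ∈ vs → B v ≡ true → A v ≡ true) ⊎ A ⊂ B
  find []       = inj₁ λ ()
  find (v ∷ vs) with find vs | A v in e | B v in e′
  ... | inj₂ p | _     | _     = inj₂ p
  ... | inj₁ p | true  | _     = inj₁ λ { (here refl) _ → e ; (there q) → p q }
  ... | inj₁ p | false | false = inj₁ λ { (here refl) r → ⊥-elim (true≢false r e′) ; (there q) → p q }
  ... | inj₁ p | false | true  = inj₂ (A⊆B , v , e′ , e)
... | inj₁ p = inj₁ λ v → p (∈-allVertices v)
... | inj₂ p = inj₂ p

stabilises : ∀ {m n} (A : VSet m n) → ∃ λ t → Stable (iter t A)
stabilises {m} {n} A with go (suc (m * n))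
  where
  go : ∀ t → (∃ λ t → Stable (iter t A)) ⊎ t ≤ card (iter t A)
  go zero    = inj₂ z≤n
  go (suc t) with go t | ⊇⊎⊂ {A = iter t A} ⊆-step
  ... | inj₁ p | _      = inj₁ p
  ... | inj₂ _ | inj₁ p = inj₁ (t , p)
  ... | inj₂ p | inj₂ q = inj₂ (≤-trans (s≤s p) (card-mono-< q))
... | inj₁ p = p
... | inj₂ p = ⊥-elim (<-irrefl refl (≤-trans p (card≤ (iter (suc (m * n)) A))))

fromMinimal : ∀ {m n} (A : VSet m n) → MinimalPercolating A → Spanning m n (card A)
fromMinimal {m} {n} A (perc , minimal) = record
  { A          = extendByFalse A
  ; S          = extendByFalse A
  ; supported  = supp-extendByFalse A
  ; percolates = percolates⇒full perc
  ; essential  = λ {B} → essential′ {B}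
  ; size       = ≤-reflexive (card-extend A)
  }
  where
  essential′ : ∀ {B} → B ⊑ extendByFalse A →
               (∀ {C} → Closed C → Supp m n C → B ⊑ C → ¬ Hole m n C) → extendByFalse A ⊑ B
  essential′ {B} B⊑A none j i e with B j i in eq
  ... | true  = refl
  ... | false with (v , Av , refl , refl) ← extendByFalse-true A j i e
               | t , stable ← stabilises {m} {n} (restrict B) =
    ⊥-elim (minimal (restrict B)
      ((λ w b → trans (sym (restrict-extend A w)) (B⊑A _ _ b)) , v , Av , eq)
      (t , λ w → full w))
    where
    f = extendByFalse (iter t (restrict {m} {n} B))
    B⊑f : B ⊑ f
    B⊑f j i b with w , _ , refl , refl ← extendByFalse-true A j i (B⊑A j i b) =
      trans (restrict-extend _ w) (⊆-iter t w b)
    full : ∀ w → iter t (restrict B) w ≡ true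
    full w with iter t (restrict B) w in ew
    ... | true  = refl
    ... | false = ⊥-elim (none (stable-closed stable) (supp-extendByFalse _) B⊑f
      (_ , _ , toℕ<n (proj₁ w) , toℕ<n (proj₂ w) , trans (restrict-extend (iter t (restrict B)) w) ew))

full⇒percolates : ∀ {m n} (A : VSet m n) →
                  (∀ {C} → Closed C → extendByFalse A ⊑ C → Full m n C) → Percolates A
full⇒percolates A full = t , λ v → trans (sym (restrict-extend (iter t A) v))
    (full (stable-closed (proj₂ (stabilises A))) A⊑ (toℕ<n (proj₁ v)) (toℕ<n (proj₂ v)))
  where
  t = proj₁ (stabilises A)
  A⊑ : extendByFalse A ⊑ extendByFalse (iter t A)
  A⊑ j i e with w , Aw , refl , refl ← extendByFalse-true A j i e =
    trans (restrict-extend (iter t A) w) (⊆-iter t w Aw)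

minimalSubset : ∀ {m n} (A : VSet m n) → Percolates A →
                ¬ ¬ (∃ λ B → B ⊆ A × MinimalPercolating B)
minimalSubset A = go (card A) A ≤-refl
  where
  go : ∀ {m n} c (A : VSet m n) → card A ≤ c → Percolates A →
       ¬ ¬ (∃ λ B → B ⊆ A × MinimalPercolating B)
  go c A A≤c perc fail = fail (A , (λ _ e → e) , perc , λ B B⊂A percB → smaller c A≤c B B⊂A percB)
    where
    smaller : ∀ c → card A ≤ c → ∀ B → B ⊂ A → ¬ Percolates B
    smaller zero    A≤c B B⊂A percB with () ← ≤-trans (card-mono-< B⊂A) A≤c
    smaller (suc c) A≤c B B⊂A percB =
      go c B (s≤s⁻¹ (≤-trans (card-mono-< B⊂A) A≤c)) percB
        λ (B′ , B′⊆B , min) → fail (B′ , (λ v e → proj₁ B⊂A v (B′⊆B v e)) , min)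

spanning≤E : ∀ {m n s e} → Spanning m n s → IsE m n e → s ≤ e
spanning≤E {m} {n} {s} {e} X (_ , maximal) = decidable-stable (s ≤? e) λ s≰e →
  minimalSubset A₀ percA λ (B , B⊆A , min) → s≰e (begin
    s                           ≤⟨ size X ⟩
    count m n (S X)             ≤⟨ count-mono m n (S⊑ B B⊆A (proj₁ min)) ⟩
    count m n (extendByFalse B) ≡⟨ sym (card-extend B) ⟩
    card B                      ≤⟨ maximal B min ⟩
    e                           ∎)
  where
  open ≤-Reasoning
  A₀ : VSet m n
  A₀ = restrict (A X)
  ⊑A₀ : A X ⊑ extendByFalse A₀
  ⊑A₀ j i e with p , q ← supported X j i e =
    subst₂ (λ j i → extendByFalse A₀ j i ≡ true) (toℕ-fromℕ< p) (toℕ-fromℕ< q)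
      (trans (restrict-extend A₀ (fromℕ< p , fromℕ< q))
        (subst₂ (λ j i → A X j i ≡ true) (sym (toℕ-fromℕ< p)) (sym (toℕ-fromℕ< q)) e))
  percA : Percolates A₀
  percA = full⇒percolates A₀ λ c A⊑C → percolates X c (λ j i e → A⊑C j i (⊑A₀ j i e))
  S⊑ : ∀ B → B ⊆ A₀ → Percolates B → S X ⊑ extendByFalse B
  S⊑ B B⊆A perc = essential X B⊑A
    λ c _ B⊑C (j , i , j<m , i<n , f) → true≢false (percolates⇒full perc c B⊑C j<m i<n) f
    where
    B⊑A : extendByFalse B ⊑ A X
    B⊑A j i e with w , Bw , refl , refl ← extendByFalse-true B j i e = B⊆A w Bw

-- Convergence

fraction-< : ∀ x m y n p d {ε} → toℚᵘ ε ≡ ℚᵘ.mkℚᵘ (pos (suc p)) d →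
             x * (suc n * suc d) < (y * suc d + suc p * suc n) * suc m →
             pos x /ℚ suc m <ℚ (pos y /ℚ suc n) +ℚ ε
fraction-< x m y n p d {ε} ε≡ lt = ℚ.toℚᵘ-cancel-< (begin-strict
  toℚᵘ (pos x /ℚ suc m)            ≃⟨ ℚ.toℚᵘ-fromℚᵘ X ⟩
  X                                <⟨ ℚᵘ.*<* (subst₂ _<ᶻ_ lhs rhs (+<+ lt)) ⟩
  Y ℚᵘ.+ ℚᵘ.mkℚᵘ (pos (suc p)) d   ≡⟨ cong (Y ℚᵘ.+_) (sym ε≡) ⟩
  Y ℚᵘ.+ toℚᵘ ε                    ≃⟨ ℚᵘ.+-congˡ (toℚᵘ ε) (ℚᵘ.≃-sym (ℚ.toℚᵘ-fromℚᵘ Y)) ⟩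
  toℚᵘ (pos y /ℚ suc n) ℚᵘ.+ toℚᵘ ε ≃⟨ ℚᵘ.≃-sym (ℚ.toℚᵘ-homo-+ (pos y /ℚ suc n) ε) ⟩
  toℚᵘ ((pos y /ℚ suc n) +ℚ ε)     ∎)
  where
  open ℚᵘ.≤-Reasoning
  X = ℚᵘ.mkℚᵘ (pos x) m
  Y = ℚᵘ.mkℚᵘ (pos y) n
  lhs : pos (x * (suc n * suc d)) ≡ pos x *ᶻ pos (suc n * suc d)
  lhs = ℤ.pos-* x (suc n * suc d)
  rhs : pos ((y * suc d + suc p * suc n) * suc m) ≡ (pos y *ᶻ pos (suc d) +ᶻ pos (suc p) *ᶻ pos (suc n)) *ᶻ pos (suc m)
  rhs = trans (ℤ.pos-* (y * suc d + suc p * suc n) (suc m)) (cong (_*ᶻ pos (suc m))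
    (trans (ℤ.pos-+ (y * suc d) (suc p * suc n)) (cong₂ _+ᶻ_ (ℤ.pos-* y (suc d)) (ℤ.pos-* (suc p) (suc n)))))

<-+⇒-< : ∀ {x y ε} → x <ℚ y +ℚ ε → x - y <ℚ ε
<-+⇒-< {x} {y} {ε} lt = subst (x - y <ℚ_) e (ℚ.+-monoˡ-< (- y) lt)
  where
  e : (y +ℚ ε) - y ≡ ε
  e = trans (cong (_- y) (ℚ.+-comm y ε)) (trans (ℚ.+-assoc ε y (- y))
        (trans (cong (ε +ℚ_) (ℚ.+-inverseʳ y)) (ℚ.+-identityʳ ε)))

∣-∣-< : ∀ {x y ε} → x <ℚ y +ℚ ε → y <ℚ x +ℚ ε → ∣ x - y ∣ <ℚ ε
∣-∣-< {x} {y} {ε} p q with ℚ.∣p∣≡p∨∣p∣≡-p (x - y)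
... | inj₁ e = subst (_<ℚ ε) (sym e) (<-+⇒-< p)
... | inj₂ e = subst (_<ℚ ε) (sym (trans e (⁻¹-anti-homo-// x y))) (<-+⇒-< q)

-- x / (m + 1) < (l + 1) / 2D and (l - 1) / 2D ≤ y / (n + 1) give a difference below 1 / D ≤ (p + 1) / D,
-- where D = d + 1.
window : ∀ l d p x y m n → (2 * suc d) * x < suc l * suc m → l * suc n ≤ (2 * suc d) * y + suc n →
         x * (suc n * suc d) < (y * suc d + suc p * suc n) * suc m
window l d p x y m n hx hy = *-cancelˡ-< 2 _ _ (begin-strict
  2 * (x * (N * D))                 ≡⟨ solve 3 (λ x N D → con 2 :* (x :* (N :* D)) := con 2 :* D :* x :* N) refl x N D ⟩
  2 * D * x * N                     <⟨ *-monoˡ-< N hx ⟩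
  suc l * M * N                     ≡⟨ solve 3 (λ l M N → (con 1 :+ l) :* M :* N := (l :* N :+ N) :* M) refl l M N ⟩
  (l * N + N) * M                   ≤⟨ *-monoˡ-≤ M (+-monoˡ-≤ N hy) ⟩
  (2 * D * y + N + N) * M           ≡⟨ solve 4 (λ y D N M → (con 2 :* D :* y :+ N :+ N) :* M := con 2 :* ((y :* D :+ (N :+ con 0)) :* M)) refl y D N M ⟩
  2 * ((y * D + (N + 0)) * M)       ≤⟨ *-monoʳ-≤ 2 (*-monoˡ-≤ M (+-monoʳ-≤ (y * D) (*-monoˡ-≤ N (s≤s (z≤n {p}))))) ⟩
  2 * ((y * D + suc p * N) * M)     ∎)
  where
  open ≤-Reasoning
  N = suc n
  M = suc m
  D = suc d

-- To be used with a = E(k,k) and b = E(N,N): a good ratio a / k² is inherited by b / N².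
descend : ∀ {M l k t r a b} → let N = r + t * (28 + k) in
          l * (k * k) ≤ M * a → l ≤ M → t * t * a ≤ b → 112 * M ≤ k → 4 * M * (28 + k) ≤ N → r ≤ 28 + k →
          l * (N * N) ≤ M * b + N * N
descend {M} {l} {k} {t} {r} {a} {b} good l≤M tile k≥ N≥ r≤ = begin
  l * (N * N)                                ≡⟨ cong (l *_) square ⟩
  l * (t * k * (t * k) + u * (t * k + N))    ≡⟨ *-distribˡ-+ l (t * k * (t * k)) _ ⟩
  l * (t * k * (t * k)) + l * (u * (t * k + N)) ≤⟨ +-mono-≤ main error ⟩
  M * b + N * N                              ∎
  where
  open ≤-Reasoning
  N = r + t * (28 + k)
  u = r + 28 * t
  square : N * N ≡ t * k * (t * k) + u * (t * k + N)
  square = solve 3 (λ r t k → (r :+ t :* (con 28 :+ k)) :* (r :+ t :* (con 28 :+ k)) :=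
    t :* k :* (t :* k) :+ (r :+ con 28 :* t) :* (t :* k :+ (r :+ t :* (con 28 :+ k)))) refl r t k
  tk≤N : t * k ≤ N
  tk≤N = ≤-trans (*-monoʳ-≤ t (m≤n+m k 28)) (m≤n+m (t * (28 + k)) r)
  main : l * (t * k * (t * k)) ≤ M * b
  main = begin
    l * (t * k * (t * k))   ≡⟨ solve 3 (λ l t k → l :* (t :* k :* (t :* k)) := t :* t :* (l :* (k :* k))) refl l t k ⟩
    t * t * (l * (k * k))   ≤⟨ *-monoʳ-≤ (t * t) good ⟩
    t * t * (M * a)         ≡⟨ solve 3 (λ t M a → t :* t :* (M :* a) := M :* (t :* t :* a)) refl t M a ⟩
    M * (t * t * a)         ≤⟨ *-monoʳ-≤ M tile ⟩
    M * b                   ∎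
  2Mu≤N : 2 * (M * u) ≤ N
  2Mu≤N = *-cancelˡ-≤ 2 (begin
    2 * (2 * (M * u))             ≡⟨ solve 3 (λ M r t → con 2 :* (con 2 :* (M :* (r :+ con 28 :* t))) :=
                                       con 4 :* M :* r :+ t :* (con 112 :* M)) refl M r t ⟩
    4 * M * r + t * (112 * M)     ≤⟨ +-mono-≤ (≤-trans (*-monoʳ-≤ (4 * M) r≤) N≥) (≤-trans (*-monoʳ-≤ t k≥) tk≤N) ⟩
    N + N                         ≡⟨ cong (N +_) (sym (+-identityʳ N)) ⟩
    2 * N                         ∎)
  error : l * (u * (t * k + N)) ≤ N * N
  error = begin
    l * (u * (t * k + N))    ≤⟨ *-mono-≤ l≤M (*-monoʳ-≤ u (+-monoˡ-≤ N tk≤N)) ⟩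
    M * (u * (N + N))        ≡⟨ solve 3 (λ M u N → M :* (u :* (N :+ N)) := con 2 :* (M :* u) :* N) refl M u N ⟩
    2 * (M * u) * N          ≤⟨ *-monoˡ-≤ N 2Mu≤N ⟩
    N * N                    ∎

module Limit (e : ℕ → ℕ) (isE : ∀ k → IsE (suc k) (suc k) (e k)) (M : ℕ) where

  bounded : ∀ n → e n ≤ suc n * suc n
  bounded n with (A , _ , card≡) , _ ← isE n = subst (_≤ suc n * suc n) card≡ (card≤ A)

  superadditive : ∀ k q n r → suc n ≡ suc q * (30 + k) + r → suc q * suc q * e (suc k) ≤ e n
  superadditive k q n r eq with (A , min , card≡) , _ ← isE (suc k) =
    subst (λ c → suc q * suc q * c ≤ e n) card≡ (spanning≤E
      (subst (λ N → Spanning N N (suc q * suc q * card A)) (sym eq) (tile q r (fromMinimal A min)))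
      (isE n))

  Eventually : ℕ → Set
  Eventually l = ∃ λ N → ∀ n → N ≤ n → M * e n < l * (suc n * suc n)

  level : ¬ ¬ (∃ λ l → Eventually (suc l) × ¬ Eventually l)
  level fail = descent (suc M) (0 , λ n _ → ≤-<-trans (*-monoʳ-≤ M (bounded n)) (*-monoˡ-< (suc n * suc n) (n<1+n M)))
    where
    descent : ∀ l → ¬ Eventually l
    descent zero    (N , below) = n≮0 (below N ≤-refl)
    descent (suc l) ev          = fail (l , ev , descent l)

  frequently : ∀ {l} → ¬ Eventually l → ∀ N → ¬ ¬ (∃ λ n → N ≤ n × l * (suc n * suc n) ≤ M * e n)
  frequently ¬ev N fail = ¬ev (N , λ n N≤n → ≰⇒> λ above → fail (n , N≤n , above))

  lowerBound : ∀ {l k} → l * (suc (suc k) * suc (suc k)) ≤ M * e (suc k) → 112 * M ≤ k →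
               ∀ n → 4 * M * (30 + k) ≤ suc n → l * (suc n * suc n) ≤ M * e n + suc n * suc n
  lowerBound {l} {k} good k≥ n n≥ =
    subst (λ N → l * (N * N) ≤ M * e n + N * N) (sym divided)
      (descend {M} {l} {2 + k} {t} {r} good l≤M tiled (≤-trans k≥ (m≤n+m k 2))
        (subst (4 * M * (30 + k) ≤_) divided n≥) (<⇒≤ (m%n<n (suc n) (30 + k))))
    where
    t = suc n / (30 + k)
    r = suc n % (30 + k)
    divided : suc n ≡ r + t * (30 + k)
    divided = m≡m%n+[m/n]*n (suc n) (30 + k)
    l≤M : l ≤ M
    l≤M = *-cancelʳ-≤ l M (suc (suc k) * suc (suc k)) (≤-trans good (*-monoʳ-≤ M (bounded (suc k))))
    tiled : t * t * e (suc k) ≤ e n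
    tiled with t in eq
    ... | zero  = z≤n
    ... | suc q = superadditive k q n r (trans divided (trans (+-comm r _) (cong (λ t → t * (30 + k) + r) eq)))

  concentrated : ¬ ¬ (∃₂ λ l N → ∀ n → N ≤ n →
                      M * e n < suc l * (suc n * suc n) ×
                      l * (suc n * suc n) ≤ M * e n + suc n * suc n)
  concentrated fail = level λ (l , (N₁ , upper) , ¬ev) →
    frequently {l} ¬ev (suc (112 * M)) λ { (suc k , s≤s k≥ , good) →
    fail (l , N₁ + 4 * M * (30 + k) , λ n n≥ →
      upper n (m+n≤o⇒m≤o N₁ n≥) ,
      lowerBound {l} good k≥ n (m≤n⇒m≤1+n (m+n≤o⇒n≤o N₁ n≥))) }

theorem1p2 : (e : ℕ → ℕ) → (∀ k → IsE (suc k) (suc k) (e k)) →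
    ∀ (ε : ℚ) → 0ℚ <ℚ ε →
    ¬ ¬ (∃ λ N → ∀ a b → N ≤ a → N ≤ b → ∣ ratio e a - ratio e b ∣ <ℚ ε)
theorem1p2 e isE (mkℚ (pos zero) d c) (*<* (+<+ ()))
theorem1p2 e isE ε@(mkℚ (pos (suc p)) d _) _ fail =
  Limit.concentrated e isE (2 * suc d) λ (l , N , bounds) →
    let near : ∀ a b → N ≤ a → N ≤ b → ratio e a <ℚ ratio e b +ℚ ε
        near a b a≥ b≥ = fraction-< (e a) (a + a * suc a) (e b) (b + b * suc b) p d refl
          (window l d p (e a) (e b) (a + a * suc a) (b + b * suc b)
            (proj₁ (bounds a a≥)) (proj₂ (bounds b b≥)))
    in fail (N , λ a b a≥ b≥ → ∣-∣-< (near a b a≥ b≥) (near b a b≥ a≥))
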